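{- The class $\mathfrak{F}_2$ of sub-normal frames determines $\mathrm{ILM}$, and the class $\mathfrak{F}_2'$ of sub-normal identity frames determines $\mathrm{ILM}$-$\vee$; that is, for every formula $\alpha\in F$: $\vdash_{\mathrm{ILM}}\alpha$ if and only if $\mathfrak{F}_2\vDash\alpha$, and $\vdash_{\mathrm{ILM}\text{ - }\vee}\alpha$ if and only if $\mathfrak{F}_2'\vDash\alpha$.
   Context: The set $F$ of formulas of $\mathrm{ILM}$ is built from propositional variables and constants $\top,\bot$ with $\wedge,\vee,\rightarrow,\neg,\sim$; $\alpha\leftrightarrow\beta$ abbreviates $(\alpha\rightarrow\beta)\wedge(\beta\rightarrow\alpha)$. Axiom schemes of $\mathrm{ILM}$: (A1) $\alpha\rightarrow(\beta\rightarrow\alpha)$; (A2) $(\alpha\rightarrow(\beta\rightarrow\gamma))\rightarrow((\alpha\rightarrow\beta)\rightarrow(\alpha\rightarrow\gamma))$; (A3) $\alpha\rightarrow(\alpha\vee\beta)$, $\beta\rightarrow(\alpha\vee\beta)$; (A4) $(\alpha\rightarrow\gamma)\rightarrow((\beta\rightarrow\gamma)\rightarrow((\alpha\vee\beta)\rightarrow\gamma))$; (A5) $(\alpha\wedge\beta)\rightarrow\alpha$, $(\alpha\wedge\beta)\rightarrow\beta$; (A6) $(\alpha\rightarrow\beta)\rightarrow((\alpha\rightarrow\gamma)\rightarrow(\alpha\rightarrow(\beta\wedge\gamma)))$; (A7) $\alpha\rightarrow\top$; (A8) $\bot\rightarrow\alpha$; (A9) $(\alpha\rightarrow\beta)\rightarrow((\alpha\rightarrow\neg\beta)\rightarrow\neg\alpha)$;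 (A10) $\neg\alpha\rightarrow(\alpha\rightarrow\beta)$; (A11) $\sim\alpha\leftrightarrow(\alpha\rightarrow\neg\neg\sim\top)$. Modus ponens is the only rule. $\mathrm{ILM}$-$\vee$ is $\mathrm{ILM}$ plus the axiom scheme $\alpha\vee\sim\alpha$. A sub-normal frame is $(W,\leq,Y_0)$ with $(W,\leq)$ a nonempty poset and $Y_0\subseteq W$ an upset such that for all $x\in W$: if for every $y\geq x$ there is $z\geq y$ with $z\in Y_0$, then $x\in Y_0$. It is a sub-normal identity frame if moreover for all $x,y\in W\setminus Y_0$, $x\leq y$ implies $y\leq x$. A valuation assigns an upset of $W$ to each propositional variable. Truth: variables via $v$; $\top$ everywhere, $\bot$ nowhere; $\wedge,\vee$ pointwise; $x\vDash\alpha\rightarrow\beta$ iff for all $y\geq x$, $y\vDash\alpha$ implies $y\vDash\beta$; $x\vDash\neg\alpha$ iff for all $y\geq x$, $y\nvDash\alpha$; $x\vDash\sim\alpha$ iff for all $y\geq x$, $y\vDash\alpha$ implies $y\in Y_0$. For a class $\mathfrak{F}$ of frames, $\mathfrak{F}\vDash\alpha$ means $\alpha$ is true at every point under every valuation on every frame in $\mathfrak{F}$. -}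

module Defs where

open import Level using (Level; suc)
open import Data.Nat using (ℕ)
open import Data.Product using (_×_; ∃-syntax)
open import Data.Sum using (_⊎_)
import Data.Empty.Polymorphic as Empty
import Data.Unit.Polymorphic as Unit
open import Function.Bundles using (_⇔_)
open import Relation.Binary.Bundles using (Poset)
open import Relation.Binary.Definitions using (_Respects_)
open import Relation.Nullary.Negation using () renaming (¬_ to Not)
open import Relation.Unary using (Pred; _∈_; _∉_; U)

infix  9 ¬_ ∼_
infixr 8 _∧_
infixr 7 _∨_
infixr 6 _⇒_
infix  5 _↔_

data Formula : Set where
  var         : ℕ → Formula
  ⊤ ⊥         : Formula
  _∧_ _∨_ _⇒_ : Formula → Formula → Formula
  ¬_ ∼_       : Formula → Formula

_↔_ : Formula → Formula → Formula
α ↔ β = (α ⇒ β) ∧ (β ⇒ α)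

data ILM : Pred Formula Level.zero where
  A1  : ∀ α β → ILM (α ⇒ (β ⇒ α))
  A2  : ∀ α β γ → ILM ((α ⇒ (β ⇒ γ)) ⇒ ((α ⇒ β) ⇒ (α ⇒ γ)))
  A3ˡ : ∀ α β → ILM (α ⇒ (α ∨ β))
  A3ʳ : ∀ α β → ILM (β ⇒ (α ∨ β))
  A4  : ∀ α β γ → ILM ((α ⇒ γ) ⇒ ((β ⇒ γ) ⇒ ((α ∨ β) ⇒ γ)))
  A5ˡ : ∀ α β → ILM ((α ∧ β) ⇒ α)
  A5ʳ : ∀ α β → ILM ((α ∧ β) ⇒ β)
  A6  : ∀ α β γ → ILM ((α ⇒ β) ⇒ ((α ⇒ γ) ⇒ (α ⇒ (β ∧ γ))))
  A7  : ∀ α → ILM (α ⇒ ⊤)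
  A8  : ∀ α → ILM (⊥ ⇒ α)
  A9  : ∀ α β → ILM ((α ⇒ β) ⇒ ((α ⇒ ¬ β) ⇒ ¬ α))
  A10 : ∀ α β → ILM (¬ α ⇒ (α ⇒ β))
  A11 : ∀ α → ILM (∼ α ↔ (α ⇒ ¬ (¬ (∼ ⊤))))

data ILM-∨ : Pred Formula Level.zero where
  ilm : ∀ {α} → ILM α → ILM-∨ α
  A∨  : ∀ α → ILM-∨ (α ∨ ∼ α)

infix 4 ⊢[_]_

data ⊢[_]_ (Ax : Pred Formula Level.zero) : Formula → Set where
  ax : ∀ {α} → Ax α → ⊢[ Ax ] α
  mp : ∀ {α β} → ⊢[ Ax ] (α ⇒ β) → ⊢[ Ax ] α → ⊢[ Ax ] β

-- As everywhere in the library, antisymmetry of the poset is with respect to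
-- its underlying setoid equality. Upsets automatically respect that equality.
record SubNormalFrame (ℓ : Level) : Set (suc ℓ) where
  field
    poset : Poset ℓ ℓ ℓ

  open Poset poset public using (_≤_) renaming (Carrier to W)

  field
    nonempty  : W
    Y₀        : Pred W ℓ
    Y₀-upset  : Y₀ Respects _≤_
    subNormal : ∀ x → (∀ y → x ≤ y → ∃[ z ] (y ≤ z × z ∈ Y₀)) → x ∈ Y₀

IsIdentity : ∀ {ℓ} → Pred (SubNormalFrame ℓ) ℓ
IsIdentity F = ∀ x y → x ∉ Y₀ → y ∉ Y₀ → x ≤ y → y ≤ x
  where open SubNormalFrame F

record Valuation {ℓ} (F : SubNormalFrame ℓ) : Set (suc ℓ) where
  open SubNormalFrame F
  field
    val   : ℕ → Pred W ℓ
    upset : ∀ p → val p Respects _≤_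

module Truth {ℓ} (F : SubNormalFrame ℓ) (v : Valuation F) where
  open SubNormalFrame F
  open Valuation v

  infix 4 _⊨_

  _⊨_ : W → Formula → Set ℓ
  x ⊨ var p   = x ∈ val p
  x ⊨ ⊤       = Unit.⊤
  x ⊨ ⊥       = Empty.⊥
  x ⊨ (α ∧ β) = (x ⊨ α) × (x ⊨ β)
  x ⊨ (α ∨ β) = (x ⊨ α) ⊎ (x ⊨ β)
  x ⊨ (α ⇒ β) = ∀ y → x ≤ y → y ⊨ α → y ⊨ β
  x ⊨ (¬ α)   = ∀ y → x ≤ y → Not (y ⊨ α)
  x ⊨ (∼ α)   = ∀ y → x ≤ y → y ⊨ α → y ∈ Y₀

infix 4 _⊩_

_⊩_ : ∀ {ℓ p} → Pred (SubNormalFrame ℓ) p → Formula → Set _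
𝔉 ⊩ α = ∀ F → F ∈ 𝔉 → ∀ v x → let open Truth F v in x ⊨ α

𝔉₂ : ∀ ℓ → Pred (SubNormalFrame ℓ) Level.zero
𝔉₂ ℓ = U

𝔉₂′ : ∀ ℓ → Pred (SubNormalFrame ℓ) ℓ
𝔉₂′ ℓ = IsIdentity

_Determines_ : ∀ {ℓ p} → Pred (SubNormalFrame ℓ) p → Pred Formula Level.zero → Set _
𝔉 Determines Ax = ∀ α → (⊢[ Ax ] α) ⇔ (𝔉 ⊩ α)

{-# OPTIONS --safe #-}

-- Soundness: persistence makes every truth set an upset, subNormal says
-- that Y₀ is closed under double negation, which is A11, and on an identity
-- frame persistence runs backwards outside Y₀, which is α ∨ ∼ α.
-- Completeness: in the canonical model of consistent prime theories take Y₀ to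
-- be the theories containing ∼ ⊤.  The frame is sub-normal because A11 proves
-- ¬ ¬ ∼ ⊤ ⇒ ∼ ⊤.  With α ∨ ∼ α, a prime theory lacking α contains ∼ α, so no
-- extension of it lacking ∼ ⊤ contains α.
module Submission where

open import Level using (Level; Lift; lift; lower)
open import Axiom.ExcludedMiddle using (ExcludedMiddle)
open import Data.Bool.Base using (Bool; T)
open import Data.Bool.Properties using (T?)
open import Data.List.Base using (List; []; _∷_; concat; map; cartesianProductWith; foldl)
open import Data.List.Membership.Propositional using () renaming (_∈_ to _∈ₗ_)
open import Data.List.Membership.Propositional.Properties
  using (∈-concat⁺′; ∈-map⁺; ∈-cartesianProductWith⁺)
open import Data.List.Relation.Unary.Any using (here; there)
open import Data.Nat.Base using (ℕ; zero; suc; _⊔_; _≤′_; ≤′-refl; ≤′-step)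
open import Data.Nat.Properties using (m≤m⊔n; m≤n⊔m; ≤⇒≤′)
open import Data.Product using (_×_; _,_; ∃-syntax)
open import Data.Sum using (_⊎_; inj₁; inj₂; [_,_]′)
open import Data.Unit.Polymorphic using (tt)
open import Function.Base using (_∘_; id)
open import Function.Bundles using (mk⇔)
open import Relation.Binary.Bundles using (Poset)
import Relation.Binary.Construct.Interior.Symmetric as Symmetric
open import Relation.Binary.PropositionalEquality using (_≡_; refl)
open import Relation.Nullary.Decidable
  using (yes; no; isYes; map′; decidable-stable; toWitness; fromWitness)
open import Relation.Nullary.Negation using (contradiction) renaming (¬_ to Not)
open import Relation.Unary using (Pred; _∈_; _∉_; _⊆_; _∪_; ｛_｝)
open import Defs

-- Persistence and soundness.

module _ {ℓ} (F : SubNormalFrame ℓ) (v : Valuation F) where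
  open SubNormalFrame F
  open Valuation v
  open Truth F v
  open Poset poset using () renaming (refl to ≤-refl; trans to ≤-trans)

  persistence : ∀ φ {x y} → x ≤ y → x ⊨ φ → y ⊨ φ
  persistence (var p) x≤y h        = upset p x≤y h
  persistence ⊤       x≤y h        = tt
  persistence (α ∧ β) x≤y (a , b)  = persistence α x≤y a , persistence β x≤y b
  persistence (α ∨ β) x≤y (inj₁ a) = inj₁ (persistence α x≤y a)
  persistence (α ∨ β) x≤y (inj₂ b) = inj₂ (persistence β x≤y b)
  persistence (α ⇒ β) x≤y h z y≤z  = h z (≤-trans x≤y y≤z)
  persistence (¬ α)   x≤y h z y≤z  = h z (≤-trans x≤y y≤z)
  persistence (∼ α)   x≤y h z y≤z  = h z (≤-trans x≤y y≤z)

  ILM-valid : ExcludedMiddle ℓ → ∀ {φ} → ILM φ → ∀ x → x ⊨ φ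
  ILM-valid em (A1 α β) x y _ a z y≤z _ = persistence α y≤z a
  ILM-valid em (A2 α β γ) x y _ f z y≤z g w z≤w a =
    f w (≤-trans y≤z z≤w) a w ≤-refl (g w z≤w a)
  ILM-valid em (A3ˡ α β) x y _ a = inj₁ a
  ILM-valid em (A3ʳ α β) x y _ b = inj₂ b
  ILM-valid em (A4 α β γ) x y _ f z y≤z g w z≤w (inj₁ a) = f w (≤-trans y≤z z≤w) a
  ILM-valid em (A4 α β γ) x y _ f z y≤z g w z≤w (inj₂ b) = g w z≤w b
  ILM-valid em (A5ˡ α β) x y _ (a , _) = a
  ILM-valid em (A5ʳ α β) x y _ (_ , b) = b
  ILM-valid em (A6 α β γ) x y _ f z y≤z g w z≤w a = f w (≤-trans y≤z z≤w) a , g w z≤w a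
  ILM-valid em (A7 α) x y _ _ = tt
  ILM-valid em (A8 α) x y _ ()
  ILM-valid em (A9 α β) x y _ f z y≤z g w z≤w a =
    g w z≤w a w ≤-refl (f w (≤-trans y≤z z≤w) a)
  ILM-valid em (A10 α β) x y _ f z y≤z a = contradiction a (f z y≤z)
  ILM-valid em (A11 α) x =
      (λ y _ h z y≤z a w z≤w n →
         n w ≤-refl (λ u w≤u _ → Y₀-upset (≤-trans z≤w w≤u) (h z y≤z a)))
    -- A point forcing `∼ ⊤` lies in `Y₀`. If no point above `w` were in `Y₀`, then `w` would force
    -- `¬ (∼ ⊤)`, against `¬ (¬ (∼ ⊤))` at `z`.
    , (λ y _ h z y≤z a → subNormal z λ w z≤w → decidable-stable em λ none →
         h z y≤z a w z≤w λ u w≤u s → none (u , w≤u , s u ≤-refl tt))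

  ∨∼-valid : ExcludedMiddle ℓ → IsIdentity F → ∀ α x → x ⊨ (α ∨ ∼ α)
  ∨∼-valid em identity α x with em {x ⊨ α}
  ... | yes a = inj₁ a
  ... | no ¬a = inj₂ λ y x≤y a → decidable-stable em λ y∉Y₀ →
    ¬a (persistence α (identity x y (y∉Y₀ ∘ Y₀-upset x≤y) y∉Y₀ x≤y) a)

  soundness : ∀ {Ax} → (∀ {φ} → Ax φ → ∀ x → x ⊨ φ) → ∀ {φ} → ⊢[ Ax ] φ → ∀ x → x ⊨ φ
  soundness valid (ax a)   x = valid a x
  soundness valid (mp d e) x = soundness valid d x x ≤-refl (soundness valid e x)

-- Derivability, with hypotheses adjoined to the axioms.

⊢-mono : ∀ {P Q} → P ⊆ Q → ∀ {φ} → ⊢[ P ] φ → ⊢[ Q ] φ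
⊢-mono P⊆Q (ax a)   = ax (P⊆Q a)
⊢-mono P⊆Q (mp d e) = mp (⊢-mono P⊆Q d) (⊢-mono P⊆Q e)

module _ {P : Pred Formula Level.zero} (ILM⊆P : ILM ⊆ P) where

  ilm-ax : ∀ {φ} → ILM φ → ⊢[ P ] φ
  ilm-ax = ax ∘ ILM⊆P

  ⇒-const : ∀ {α β} → ⊢[ P ] β → ⊢[ P ] (α ⇒ β)
  ⇒-const = mp (ilm-ax (A1 _ _))

  ⇒-mp : ∀ {α β γ} → ⊢[ P ] (α ⇒ (β ⇒ γ)) → ⊢[ P ] (α ⇒ β) → ⊢[ P ] (α ⇒ γ)
  ⇒-mp d = mp (mp (ilm-ax (A2 _ _ _)) d)

  ⇒-trans : ∀ {α β γ} → ⊢[ P ] (α ⇒ β) → ⊢[ P ] (β ⇒ γ) → ⊢[ P ] (α ⇒ γ)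
  ⇒-trans d e = ⇒-mp (⇒-const e) d

  ⇒-refl : ∀ {α} → ⊢[ P ] (α ⇒ α)
  ⇒-refl {α} = ⇒-mp (ilm-ax (A1 α (α ⇒ α))) (ilm-ax (A1 α α))

  -- Modus ponens is the only rule, so induction on the derivation needs only A1 and A2.
  deduction : ∀ {α β} → ⊢[ P ∪ ｛ α ｝ ] β → ⊢[ P ] (α ⇒ β)
  deduction (ax (inj₁ p))    = ⇒-const (ax p)
  deduction (ax (inj₂ refl)) = ⇒-refl
  deduction (mp d e)         = ⇒-mp (deduction d) (deduction e)

  ¬-intro : ∀ {α} → ⊢[ P ] (α ⇒ ⊥) → ⊢[ P ] (¬ α)
  ¬-intro d = mp (mp (ilm-ax (A9 _ ⊥)) d) (⇒-trans d (ilm-ax (A8 _)))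

  ∼⇒-¬¬∼⊤ : ∀ {α} → ⊢[ P ] (∼ α) → ⊢[ P ] (α ⇒ ¬ (¬ (∼ ⊤)))
  ∼⇒-¬¬∼⊤ = mp (mp (ilm-ax (A5ˡ _ _)) (ilm-ax (A11 _)))

  ¬¬∼⊤-∼ : ∀ {α} → ⊢[ P ] (α ⇒ ¬ (¬ (∼ ⊤))) → ⊢[ P ] (∼ α)
  ¬¬∼⊤-∼ = mp (mp (ilm-ax (A5ʳ _ _)) (ilm-ax (A11 _)))

  -- A11 read at `⊤`; the syntactic counterpart of `subNormal`.
  ∼⊤-stable : ⊢[ P ] (¬ (¬ (∼ ⊤))) → ⊢[ P ] (∼ ⊤)
  ∼⊤-stable = ¬¬∼⊤-∼ ∘ ⇒-const

  -- Lets `∼ α` act as `α ⇒ ∼ ⊤`, matching its truth clause when `Y₀` consists of the theories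
  -- containing `∼ ⊤`.
  ∼-elim : ∀ {α} → ⊢[ P ] (∼ α) → ⊢[ P ] α → ⊢[ P ] (∼ ⊤)
  ∼-elim d e = ∼⊤-stable (mp (∼⇒-¬¬∼⊤ d) e)

  ¬¬-intro : ∀ {α} → ⊢[ P ] α → ⊢[ P ] (¬ (¬ α))
  ¬¬-intro {α} d = mp (mp (ilm-ax (A9 (¬ α) α)) (⇒-const d)) ⇒-refl

  case : ∀ {α β γ} → ⊢[ P ] (α ∨ β) → ⊢[ P ] (α ⇒ γ) → ⊢[ P ] (β ⇒ γ) → ⊢[ P ] γ
  case d e f = mp (mp (mp (ilm-ax (A4 _ _ _)) e) f) d

-- Enumeration of the formulas by finite lists.

formulas : ℕ → List Formula
pieces   : ℕ → List (List Formula)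

formulas zero    = []
formulas (suc n) = concat (pieces n)

pieces n =
    -- Keeping the earlier list makes the lists cumulative, so two subformulas found at different
    -- indices meet in a common list.
    formulas n
  ∷ (⊤ ∷ ⊥ ∷ var n ∷ [])
  ∷ map ¬_ (formulas n)
  ∷ map ∼_ (formulas n)
  ∷ cartesianProductWith _∧_ (formulas n) (formulas n)
  ∷ cartesianProductWith _∨_ (formulas n) (formulas n)
  ∷ cartesianProductWith _⇒_ (formulas n) (formulas n)
  ∷ []

piece⊆formulas : ∀ n {φ ψs} → ψs ∈ₗ pieces n → φ ∈ₗ ψs → φ ∈ₗ formulas (suc n)
piece⊆formulas n ψs∈ φ∈ = ∈-concat⁺′ {xss = pieces n} φ∈ ψs∈

formulas-mono : ∀ {m n φ} → m ≤′ n → φ ∈ₗ formulas m → φ ∈ₗ formulas n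
formulas-mono ≤′-refl i = i
formulas-mono (≤′-step {n = n} m≤n) i = piece⊆formulas n (here refl) (formulas-mono m≤n i)

formulas-complete : ∀ φ → ∃[ n ] φ ∈ₗ formulas n

formulas-complete₂ : ∀ α β → ∃[ n ] (α ∈ₗ formulas n × β ∈ₗ formulas n)
formulas-complete₂ α β with formulas-complete α | formulas-complete β
... | m , i | n , j =
  m ⊔ n , formulas-mono (≤⇒≤′ (m≤m⊔n m n)) i , formulas-mono (≤⇒≤′ (m≤n⊔m m n)) j

formulas-complete (var p) = suc p , piece⊆formulas p (there (here refl)) (there (there (here refl)))
formulas-complete ⊤       = 1 , here refl
formulas-complete ⊥       = 1 , there (here refl)
formulas-complete (¬ α) with formulas-complete α
... | n , i = suc n , piece⊆formulas n (there (there (here refl))) (∈-map⁺ ¬_ i)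
formulas-complete (∼ α) with formulas-complete α
... | n , i = suc n , piece⊆formulas n (there (there (there (here refl)))) (∈-map⁺ ∼_ i)
formulas-complete (α ∧ β) with formulas-complete₂ α β
... | n , i , j = suc n , piece⊆formulas n
  (there (there (there (there (here refl))))) (∈-cartesianProductWith⁺ _∧_ i j)
formulas-complete (α ∨ β) with formulas-complete₂ α β
... | n , i , j = suc n , piece⊆formulas n
  (there (there (there (there (there (here refl)))))) (∈-cartesianProductWith⁺ _∨_ i j)
formulas-complete (α ⇒ β) with formulas-complete₂ α β
... | n , i , j = suc n , piece⊆formulas n
  (there (there (there (there (there (there (here refl))))))) (∈-cartesianProductWith⁺ _⇒_ i j)

-- Extension to a theory maximal among those not deriving `χ`.

module Maximal (χ : Formula) where

  -- The condition for adding ψ is part of membership, so the chain of theories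
  -- is defined without deciding provability.
  add : Pred Formula Level.zero → Formula → Pred Formula Level.zero
  add P ψ = P ∪ λ φ → ψ ≡ φ × Not (⊢[ P ∪ ｛ ψ ｝ ] χ)

  -- If `P ∪ ｛ ψ ｝` derived `χ`, the condition in `add` would fail and `add P ψ` would collapse to
  -- `P`. A derivation from `add P ψ` is also one from `P ∪ ｛ ψ ｝`, so it is refuted without
  -- deciding the condition.
  add-⊬ : ∀ {P} ψ → Not (⊢[ P ] χ) → Not (⊢[ add P ψ ] χ)
  add-⊬ {P} ψ ⊬χ d = refuted (⊢-mono (λ { (inj₁ p) → inj₁ p ; (inj₂ (e , _)) → inj₂ e }) d)
    where
    refuted : Not (⊢[ P ∪ ｛ ψ ｝ ] χ)
    refuted e = ⊬χ (⊢-mono (λ { (inj₁ p) → p ; (inj₂ (_ , r)) → contradiction e r }) d)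

  foldl-⊬ : ∀ {P} ψs → Not (⊢[ P ] χ) → Not (⊢[ foldl add P ψs ] χ)
  foldl-⊬ []       ⊬χ = ⊬χ
  foldl-⊬ (ψ ∷ ψs) ⊬χ = foldl-⊬ ψs (add-⊬ ψ ⊬χ)

  foldl-extends : ∀ {P} ψs → P ⊆ foldl add P ψs
  foldl-extends []       p = p
  foldl-extends (ψ ∷ ψs) p = foldl-extends ψs (inj₁ p)

  foldl-maximal : ∀ {P ψ ψs} → ψ ∈ₗ ψs → ψ ∉ foldl add P ψs →
                  Not (Not (⊢[ foldl add P ψs ∪ ｛ ψ ｝ ] χ))
  foldl-maximal {ψs = ψ ∷ ψs} (here refl) ψ∉ ⊬χ =
    ψ∉ (foldl-extends ψs (inj₂ (refl , ⊬χ ∘ ⊢-mono [ inj₁ ∘ foldl-extends ψs ∘ inj₁ , inj₂ ]′)))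
  foldl-maximal {ψs = _ ∷ ψs} (there i) = foldl-maximal i

  module _ (P : Pred Formula Level.zero) where

    stage : ℕ → Pred Formula Level.zero
    stage zero    = P
    stage (suc n) = foldl add (stage n) (formulas n)

    limit : Pred Formula Level.zero
    limit φ = ∃[ n ] φ ∈ stage n

    stage-mono : ∀ {m n} → m ≤′ n → stage m ⊆ stage n
    stage-mono ≤′-refl                s = s
    stage-mono (≤′-step {n = n} m≤n) s = foldl-extends (formulas n) (stage-mono m≤n s)

    stage-⊬ : Not (⊢[ P ] χ) → ∀ n → Not (⊢[ stage n ] χ)
    stage-⊬ ⊬χ zero    = ⊬χ
    stage-⊬ ⊬χ (suc n) = foldl-⊬ (formulas n) (stage-⊬ ⊬χ n)

    -- A derivation uses finitely many axioms and the stages increase, so a single stage holds them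
    -- all.
    limit-compact : ∀ {φ} → ⊢[ limit ] φ → ∃[ n ] (⊢[ stage n ] φ)
    limit-compact (ax (n , s)) = n , ax s
    limit-compact (mp d e) with limit-compact d | limit-compact e
    ... | m , d′ | n , e′ = m ⊔ n , mp (⊢-mono (stage-mono (≤⇒≤′ (m≤m⊔n m n))) d′)
                                       (⊢-mono (stage-mono (≤⇒≤′ (m≤n⊔m m n))) e′)

    limit-⊬ : Not (⊢[ P ] χ) → Not (⊢[ limit ] χ)
    limit-⊬ ⊬χ d with limit-compact d
    ... | n , d′ = stage-⊬ ⊬χ n d′

    limit-maximal : ∀ {ψ} → ψ ∉ limit → Not (Not (⊢[ limit ∪ ｛ ψ ｝ ] χ))
    limit-maximal {ψ} ψ∉ ⊬χ with formulas-complete ψ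
    ... | n , i = foldl-maximal i (ψ∉ ∘ (suc n ,_)) (⊬χ ∘ ⊢-mono [ inj₁ ∘ (suc n ,_) , inj₂ ]′)

-- The canonical model and completeness.

module Canonical {ℓ} (em : ExcludedMiddle ℓ)
                 {Ax : Pred Formula Level.zero} (ILM⊆Ax : ILM ⊆ Ax) where

  em₀ : ExcludedMiddle Level.zero
  em₀ = map′ lower lift (em {Lift ℓ _})

  -- Theories are Bool-valued so that worlds fit in Set ℓ for every ℓ.
  record World : Set ℓ where
    field
      member : Formula → Bool

    theory : Pred Formula Level.zero
    theory = T ∘ member

    field
      axioms     : Ax ⊆ theory
      closed     : ∀ {φ} → ⊢[ theory ] φ → φ ∈ theory
      consistent : ⊥ ∉ theory
      prime      : ∀ {α β} → (α ∨ β) ∈ theory → α ∈ theory ⊎ β ∈ theory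

    logic : ILM ⊆ theory
    logic = axioms ∘ ILM⊆Ax

    stable : ∀ {φ} → Not (φ ∉ theory) → φ ∈ theory
    stable = decidable-stable (T? _)

  open World

  -- By maximality every formula outside `M` implies `χ`. Hence a derivable formula outside `M`, or
  -- a disjunction in `M` with both disjuncts outside, would yield `χ`; this gives closure and
  -- primeness.
  lindenbaum : ∀ {P χ} → Ax ⊆ P → Not (⊢[ P ] χ) → ∃[ w ] (P ⊆ theory w × χ ∉ theory w)
  lindenbaum {P} {χ} Ax⊆P ⊬χ = w , (λ p → into (0 , p)) , λ t → M⊬χ (ax (out t))
    where
    open Maximal χ

    M : Pred Formula Level.zero
    M = limit P

    into : ∀ {φ} → φ ∈ M → T (isYes (em₀ {M φ}))
    into = fromWitness

    out : ∀ {φ} → T (isYes (em₀ {M φ})) → φ ∈ M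
    out = toWitness

    Ax⊆M : Ax ⊆ M
    Ax⊆M a = 0 , Ax⊆P a

    M⊬χ : Not (⊢[ M ] χ)
    M⊬χ = limit-⊬ P ⊬χ

    refutes : ∀ {ψ} → ψ ∉ M → ⊢[ M ] (ψ ⇒ χ)
    refutes ψ∉ = deduction (Ax⊆M ∘ ILM⊆Ax) (decidable-stable em₀ (limit-maximal P ψ∉))

    M-closed : ∀ {φ} → ⊢[ M ] φ → φ ∈ M
    M-closed d = decidable-stable em₀ λ φ∉ → M⊬χ (mp (refutes φ∉) d)

    w : World
    w .member       = λ φ → isYes (em₀ {M φ})
    w .axioms a     = into (Ax⊆M a)
    w .closed d     = into (M-closed (⊢-mono out d))
    w .consistent b = M⊬χ (mp (ilm-ax (Ax⊆M ∘ ILM⊆Ax) (A8 χ)) (ax (out b)))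
    w .prime {α} {β} d with em₀ {M α} | em₀ {M β}
    ... | yes _ | _     = inj₁ _
    ... | no _  | yes _ = inj₂ _
    ... | no α∉ | no β∉ = contradiction
      (case (Ax⊆M ∘ ILM⊆Ax) (ax (out d)) (refutes α∉) (refutes β∉)) M⊬χ

  _⊑_ : World → World → Set ℓ
  x ⊑ y = Lift ℓ (theory x ⊆ theory y)

  -- Otherwise, by the deduction theorem, the theory of `x` with `α` does not derive `β`, and
  -- `lindenbaum` supplies a world above `x` containing `α` but not `β`.
  ⇒-∈ : ∀ {x α β} → (∀ y → x ⊑ y → α ∈ theory y → β ∈ theory y) → (α ⇒ β) ∈ theory x
  ⇒-∈ {x} {α} h = stable x λ ∉x →
    let y , x∪α⊆y , ∉y = lindenbaum (inj₁ ∘ axioms x) (∉x ∘ closed x ∘ deduction (logic x))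
    in ∉y (h y (lift (x∪α⊆y ∘ inj₁)) (x∪α⊆y (inj₂ refl)))

  ¬-∈ : ∀ {x α} → (∀ y → x ⊑ y → α ∉ theory y) → (¬ α) ∈ theory x
  ¬-∈ {x} h = closed x (¬-intro (logic x) (ax (⇒-∈ {x} λ y x⊑y a → contradiction a (h y x⊑y))))

  mp-∈ : ∀ x {α β} → (α ⇒ β) ∈ theory x → α ∈ theory x → β ∈ theory x
  mp-∈ x f a = closed x (mp (ax f) (ax a))

  ¬-∉ : ∀ x {α} → (¬ α) ∈ theory x → α ∉ theory x
  ¬-∉ x n a = consistent x (mp-∈ x (mp-∈ x (logic x (A10 _ ⊥)) n) a)

  -- Worlds exist only if `Ax` is consistent, so the witness for `nonempty` is taken as an argument.
  frame : World → SubNormalFrame ℓ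
  frame w = record
    -- Equality of worlds is mutual inclusion of theories, so antisymmetry holds although worlds
    -- also carry proofs.
    { poset     = Symmetric.poset {R = _⊑_} (lift id) λ p q → lift (lower q ∘ lower p)
    ; nonempty  = w
    ; Y₀        = λ x → Lift ℓ ((∼ ⊤) ∈ theory x)
    ; Y₀-upset  = λ x⊑y n → lift (lower x⊑y (lower n))
    -- If `¬ (∼ ⊤)` were in some `y` above `x`, a world of `Y₀` above `y` would contain both it and
    -- `∼ ⊤`. So `¬ (¬ (∼ ⊤))` is in `x`.
    ; subNormal = λ x h → lift (closed x (∼⊤-stable (logic x) (ax
        (¬-∈ {x} λ y x⊑y n → let z , y⊑z , s = h y x⊑y in ¬-∉ z (lower y⊑z n) (lower s)))))
    }

  valuation : ∀ w → Valuation (frame w)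
  valuation w = record
    { val   = λ p x → Lift ℓ (var p ∈ theory x)
    ; upset = λ p x⊑y a → lift (lower x⊑y (lower a))
    }

  module _ (w : World) where
    open Truth (frame w) (valuation w)

    -- The truth lemma. Its halves are mutually inductive because `⇒`, `¬` and `∼` call the opposite
    -- half on their antecedent or argument.
    ⊨⇒∈ : ∀ φ {x} → x ⊨ φ → φ ∈ theory x
    ∈⇒⊨ : ∀ φ {x} → φ ∈ theory x → x ⊨ φ

    ⊨⇒∈ (var p) h = lower h
    ⊨⇒∈ ⊤ {x} h = closed x (mp (ilm-ax (logic x) (A7 (⊤ ⇒ ⊤))) (⇒-refl (logic x)))
    ⊨⇒∈ (α ∧ β) {x} (a , b) = closed x
      (mp (mp (mp (ilm-ax (logic x) (A6 α α β)) (⇒-refl (logic x)))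
              (⇒-const (logic x) (ax (⊨⇒∈ β b))))
          (ax (⊨⇒∈ α a)))
    ⊨⇒∈ (α ∨ β) {x} (inj₁ a) = mp-∈ x (logic x (A3ˡ α β)) (⊨⇒∈ α a)
    ⊨⇒∈ (α ∨ β) {x} (inj₂ b) = mp-∈ x (logic x (A3ʳ α β)) (⊨⇒∈ β b)
    ⊨⇒∈ (α ⇒ β) {x} h = ⇒-∈ {x} λ y x⊑y a → ⊨⇒∈ β (h y x⊑y (∈⇒⊨ α a))
    ⊨⇒∈ (¬ α) {x} h = ¬-∈ {x} λ y x⊑y a → h y x⊑y (∈⇒⊨ α a)
    -- By A11 it suffices that `α ⇒ ¬ (¬ (∼ ⊤))` is in `x`. A world above `x` containing `α` lies in
    -- `Y₀`, so it contains `∼ ⊤` and hence its double negation.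
    ⊨⇒∈ (∼ α) {x} h = closed x (¬¬∼⊤-∼ (logic x) (ax (⇒-∈ {x} λ y x⊑y a →
      closed y (¬¬-intro (logic y) (ax (lower (h y x⊑y (∈⇒⊨ α a))))))))

    ∈⇒⊨ (var p) h = lift h
    ∈⇒⊨ ⊤ h = tt
    ∈⇒⊨ ⊥ {x} h = contradiction h (consistent x)
    ∈⇒⊨ (α ∧ β) {x} h =
      ∈⇒⊨ α (mp-∈ x (logic x (A5ˡ α β)) h) , ∈⇒⊨ β (mp-∈ x (logic x (A5ʳ α β)) h)
    ∈⇒⊨ (α ∨ β) {x} h with prime x h
    ... | inj₁ a = inj₁ (∈⇒⊨ α a)
    ... | inj₂ b = inj₂ (∈⇒⊨ β b)
    ∈⇒⊨ (α ⇒ β) h y x⊑y a = ∈⇒⊨ β (mp-∈ y (lower x⊑y h) (⊨⇒∈ α a))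
    ∈⇒⊨ (¬ α) h y x⊑y a = ¬-∉ y (lower x⊑y h) (⊨⇒∈ α a)
    ∈⇒⊨ (∼ α) h y x⊑y a =
      lift (closed y (∼-elim (logic y) (ax (lower x⊑y h)) (ax (⊨⇒∈ α a))))

  frame-identity : (∀ α → Ax (α ∨ ∼ α)) → ∀ w → IsIdentity (frame w)
  frame-identity α∨∼α w x y _ y∉Y₀ x⊑y = lift λ {φ} φ∈y →
    [ id
    , (λ n → contradiction
        (lift (closed y (∼-elim (logic y) (ax (lower x⊑y n)) (ax φ∈y)))) y∉Y₀)
    ]′ (prime x (axioms x (α∨∼α φ)))

  -- An unprovable `α` is missing from some world `w`, which then serves both as the witness of
  -- nonemptiness and as the point refuting `α`.
  completeness : ∀ {p} {𝔉 : Pred (SubNormalFrame ℓ) p} → (∀ w → frame w ∈ 𝔉) →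
                 ∀ {α} → 𝔉 ⊩ α → ⊢[ Ax ] α
  completeness frame∈𝔉 {α} valid = decidable-stable em₀ λ ⊬α →
    let w , _ , α∉w = lindenbaum id ⊬α
    in α∉w (⊨⇒∈ w α (valid (frame w) (frame∈𝔉 w) (valuation w) w))

corollary5p8 : (ℓ : Level) → ExcludedMiddle ℓ → (𝔉₂ ℓ Determines ILM) × (𝔉₂′ ℓ Determines ILM-∨)
corollary5p8 ℓ em =
    (λ α → mk⇔ (λ d F _ v → soundness F v (ILM-valid F v em) d)
               (Canonical.completeness em id _))
  , (λ α → mk⇔ (λ d F identity v → soundness F v (ILM-∨-valid F v identity) d)
               (completeness (frame-identity A∨)))
  where
  open Canonical em ilm

  ILM-∨-valid : ∀ F v → IsIdentity F → ∀ {φ} → ILM-∨ φ → ∀ x → Truth._⊨_ F v x φ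
  ILM-∨-valid F v identity (ilm a) = ILM-valid F v em a
  ILM-∨-valid F v identity (A∨ α)  = ∨∼-valid F v em identity α
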